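{- Let $G$ be a matrix weighted connected graph of order $n$ in which each weight matrix is positive definite of order $k$, and let $L=L(G)$ and $R=R(G)$. Put $\tau_i=2I_k+\sum_{j\in V(G)}L_{ij}R_{ij}$ for $i=1,\dots,n$, and let $\tau=(\tau_1,\tau_2,\dots,\tau_n)^T$ be the $nk\times k$ block column with blocks $\tau_1,\dots,\tau_n$. Then $$(\mathbf{1}^T\otimes I_k)\,\tau=2I_k.$$
   Context: A matrix weighted graph is a finite, simple, undirected, connected graph in which each edge $ij$ is assigned a weight $W_{ij}=W_{ji}$ that is a (real symmetric) positive definite matrix of a given order $k$. For a matrix weighted graph $G$ with vertices $1,\dots,n$, the Laplacian $L=L(G)$ is the $nk\times nk$ block matrix with $k\times k$ blocks $L_{ii}=\sum_{j\sim i}W_{ij}^{ -1}$, $L_{ij}=-W_{ij}^{ -1}$ if $i\neq j$ and $i\sim j$, and $L_{ij}=0$ if $i\ne j$ and $i\nsim j$. A $(1)$-inverse of a matrix $M$ is a matrix $C$ with $MCM=M$. The resistance matrix $R=R(G)$ is the $nk\times nk$ block matrix with blocks $R_{ij}=L^{(1)}_{ii}+L^{(1)}_{jj}-L^{(1)}_{ij}-L^{(1)}_{ji}$, where $L^{(1)}$ is any $(1)$-inverse of $L$ (the result does not depend on the choice). $\mathbf{1}$ is the all-ones column vector of length $n$, $I_k$ is the identity matrix of order $k$, and $\otimes$ is the Kronecker product. -}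

module Defs where

open import Algebra.Apartness.Bundles using (HeytingField)
open import Algebra.Bundles using (CommutativeRing)
open import Algebra.Core using (Op₁)
import Algebra.Apartness.Properties.HeytingCommutativeRing as HCRProperties
import Algebra.Definitions as AlgDefs
import Algebra.Definitions.RawMonoid as RawMonoidDefs
import Algebra.Properties.Ring as RingProperties
import Algebra.Properties.Semiring.Sum as SemiringSum
open import Data.Empty using (⊥-elim)
open import Data.Fin.Base using (Fin; zero; suc; cast; combine; quotient; remainder)
import Data.Fin.Properties as Fin
open import Data.Nat.Base as ℕ using (ℕ; zero; suc)
open import Data.Product using (∃-syntax; _×_; _,_; proj₁; proj₂)
open import Data.Sum using (_⊎_; inj₁; inj₂)
open import Data.Vec.Functional as Vector using (Vector; _∷_)
open import Level using (Level; _⊔_; 0ℓ) renaming (suc to lsuc)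
open import Relation.Binary.Construct.Closure.ReflexiveTransitive using (Star)
open import Relation.Binary.Core using (Rel)
open import Relation.Binary.Definitions using (Decidable; Irreflexive; Symmetric)
open import Relation.Binary.PropositionalEquality as ≡ using (_≡_)
import Relation.Binary.Reasoning.Setoid as SetoidReasoning
open import Relation.Binary.Structures using (IsStrictPartialOrder)
open import Relation.Nullary using (yes; no)

-- The real numbers, given axiomatically as a Cauchy-complete Archimedean ordered
-- field.  Classically this determines ℝ up to unique isomorphism.  No decidability
-- is assumed, so constructively defined reals are covered too; as usual in that
-- setting, "x ≠ y" is expressed by the apartness x # y, i.e. x < y or y < x.
record RealNumbers (c ℓ₁ ℓ₂ : Level) : Set (lsuc (c ⊔ ℓ₁ ⊔ ℓ₂)) where
  field
    heytingField : HeytingField c ℓ₁ ℓ₂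

  open HeytingField heytingField public

  commutativeRing : CommutativeRing c ℓ₁
  commutativeRing = record { isCommutativeRing = isCommutativeRing }

  open CommutativeRing commutativeRing public
    using (ring; semiring; +-rawMonoid)
  open RawMonoidDefs +-rawMonoid public
    using () renaming (_×_ to _·_)

  infix 4 _<_
  field
    _<_                  : Rel Carrier ℓ₂
    isStrictPartialOrder : IsStrictPartialOrder _≈_ _<_
    #⇒<⊎>                : ∀ {x y} → x # y → x < y ⊎ y < x
    <⇒#                  : ∀ {x y} → x < y → x # y
    +-monoˡ-<            : ∀ z {x y} → x < y → x + z < y + z
    *-pos                : ∀ {x y} → 0# < x → 0# < y → 0# < x * y
    archimedean          : ∀ x → ∃[ n ] x < n · 1#

  IsCauchy : (ℕ → Carrier) → Set (c ⊔ ℓ₂)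
  IsCauchy s = ∀ {ε} → 0# < ε → ∃[ N ] (∀ m n → N ℕ.≤ m → N ℕ.≤ n → s m - s n < ε)

  _ConvergesTo_ : (ℕ → Carrier) → Carrier → Set (c ⊔ ℓ₂)
  s ConvergesTo x =
    ∀ {ε} → 0# < ε → ∃[ N ] (∀ n → N ℕ.≤ n → (s n - x < ε) × (x - s n < ε))

  field
    complete : ∀ s → IsCauchy s → ∃[ x ] s ConvergesTo x

record Graph (n : ℕ) : Set₁ where
  infix 4 _~_ _~?_
  field
    _~_      : Rel (Fin n) 0ℓ
    _~?_     : Decidable _~_
    ~-irrefl : Irreflexive _≡_ _~_
    ~-sym    : Symmetric _~_

record IsConnected {n} (G : Graph n) : Set where
  open Graph G
  field
    nonEmpty : ℕ.NonZero n
    path     : ∀ i j → Star _~_ i j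

module RealMatrices {c ℓ₁ ℓ₂} (ℝ : RealNumbers c ℓ₁ ℓ₂) where

  open RealNumbers ℝ hiding (zero)
  open SemiringSum semiring

  2# : Carrier
  2# = 1# + 1#

  Matrix : ℕ → ℕ → Set c
  Matrix m n = Vector (Vector Carrier n) m

  infix  4 _≈ᴹ_ _≈ᵛ_
  infixl 6 _+ᴹ_ _-ᴹ_
  infixl 7 _*ᴹ_ _⊗_ _*ᵛ_ _*ₗ_
  infix  7 _∙_
  infix  8 -ᴹ_ _ᵀ

  _≈ᴹ_ : ∀ {m n} → Rel (Matrix m n) ℓ₁
  A ≈ᴹ B = ∀ i j → A i j ≈ B i j

  _≈ᵛ_ : ∀ {n} → Rel (Vector Carrier n) ℓ₁
  x ≈ᵛ y = ∀ i → x i ≈ y i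

  0ᴹ : ∀ {m n} → Matrix m n
  0ᴹ i j = 0#

  I : ∀ n → Matrix n n
  I n i j with i Fin.≟ j
  ... | yes _ = 1#
  ... | no  _ = 0#

  𝟏 : ∀ n → Matrix n 1
  𝟏 n i j = 1#

  _+ᴹ_ _-ᴹ_ : ∀ {m n} → Matrix m n → Matrix m n → Matrix m n
  (A +ᴹ B) i j = A i j + B i j
  (A -ᴹ B) i j = A i j - B i j

  -ᴹ_ : ∀ {m n} → Op₁ (Matrix m n)
  (-ᴹ A) i j = - A i j

  _*ₗ_ : ∀ {m n} → Carrier → Matrix m n → Matrix m n
  (r *ₗ A) i j = r * A i j

  _*ᴹ_ : ∀ {m n p} → Matrix m n → Matrix n p → Matrix m p
  _*ᴹ_ {n = n} A B i j = ∑[ l < n ] (A i l * B l j)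

  _ᵀ : ∀ {m n} → Matrix m n → Matrix n m
  (A ᵀ) i j = A j i

  ∑ᴹ : ∀ {n p q} → (Fin n → Matrix p q) → Matrix p q
  ∑ᴹ {n} M a b = ∑[ i < n ] M i a b

  _∙_ : ∀ {n} → Vector Carrier n → Vector Carrier n → Carrier
  _∙_ {n} x y = ∑[ i < n ] (x i * y i)

  _*ᵛ_ : ∀ {m n} → Matrix m n → Vector Carrier n → Vector Carrier m
  (A *ᵛ x) i = A i ∙ x

  -- Row (i , a) of an (m * p)-row block matrix, i.e. row a of block row i, has
  -- index combine i a = i * p + a; likewise for columns.
  fromBlocks : ∀ {m n p q} → (Fin m → Fin n → Matrix p q) → Matrix (m ℕ.* p) (n ℕ.* q)
  fromBlocks {m} {n} {p} {q} B r s =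
    B (quotient p r) (quotient q s) (remainder {m} p r) (remainder {n} q s)

  block : ∀ {m n p q} → Matrix (m ℕ.* p) (n ℕ.* q) → Fin m → Fin n → Matrix p q
  block A i j a b = A (combine i a) (combine j b)

  blockColumn : ∀ {n p q} → (Fin n → Matrix p q) → Matrix (n ℕ.* p) q
  blockColumn {n} {p} B r = B (quotient p r) (remainder {n} p r)

  _⊗_ : ∀ {m n p q} → Matrix m n → Matrix p q → Matrix (m ℕ.* p) (n ℕ.* q)
  A ⊗ B = fromBlocks (λ i j → A i j *ₗ B)

  castRows : ∀ {m n p} → .(m ≡ n) → Matrix m p → Matrix n p
  castRows eq A i = A (cast (≡.sym eq) i)

  _IsOneInverseOf_ : ∀ {m n} → Matrix n m → Matrix m n → Set ℓ₁
  C IsOneInverseOf M = M *ᴹ C *ᴹ M ≈ᴹ M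

  Invertibleᴹ : ∀ {k} → Matrix k k → Set (c ⊔ ℓ₁)
  Invertibleᴹ {k} = AlgDefs.Invertible _≈ᴹ_ (I k) _*ᴹ_

  record IsPositiveDefinite {k} (W : Matrix k k) : Set (c ⊔ ℓ₁ ⊔ ℓ₂) where
    field
      symmetric : W ᵀ ≈ᴹ W
      positive  : ∀ x → (∃[ i ] x i # 0#) → 0# < x ∙ (W *ᵛ x)

  private module <-Order = IsStrictPartialOrder isStrictPartialOrder
  open RingProperties ring
    using (-‿distribˡ-*; -‿distribʳ-*; -0#≈0#)
  open HCRProperties heytingCommutativeRing using (1#0; x-0≈x; #-congʳ)
  open SetoidReasoning setoid

  x-y+y≈x : ∀ x y → (x - y) + y ≈ x
  x-y+y≈x x y = trans (+-assoc x (- y) y) (trans (+-congˡ (-‿inverseˡ y)) (+-identityʳ x))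

  *-distribˡ-- : ∀ x y z → x * (y - z) ≈ x * y - x * z
  *-distribˡ-- x y z = trans (distribˡ x y (- z)) (+-congˡ (sym (-‿distribʳ-* x z)))

  sum-zero : ∀ {n} {f : Vector Carrier n} → (∀ i → f i ≈ 0#) → sum f ≈ 0#
  sum-zero {n} f≈0 = trans (sum-cong-≋ f≈0) (sum-replicate-zero n)

  sum-neg : ∀ {n} (f : Vector Carrier n) → ∑[ i < n ] (- f i) ≈ - sum f
  sum-neg f = begin
    ∑[ i < _ ] (- f i)          ≈⟨ sum-cong-≋ (λ i → -1*x (f i)) ⟨
    ∑[ i < _ ] (- 1# * f i)     ≈⟨ *-distribˡ-sum (- 1#) f ⟨
    - 1# * sum f                ≈⟨ -1*x (sum f) ⟩
    - sum f                     ∎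
    where
    -1*x : ∀ x → - 1# * x ≈ - x
    -1*x x = trans (sym (-‿distribˡ-* 1# x)) (-‿cong (*-identityˡ x))

  *ᴹ-assoc : ∀ {m n p q} (A : Matrix m n) (B : Matrix n p) (D : Matrix p q) →
             A *ᴹ B *ᴹ D ≈ᴹ A *ᴹ (B *ᴹ D)
  *ᴹ-assoc {m} {n} {p} {q} A B D i j = begin
    ∑[ l < p ] ((∑[ h < n ] (A i h * B h l)) * D l j)
      ≈⟨ sum-cong-≋ (λ l → *-distribʳ-sum (D l j) (λ h → A i h * B h l)) ⟩
    ∑[ l < p ] ∑[ h < n ] (A i h * B h l * D l j)
      ≈⟨ ∑-comm (λ l h → A i h * B h l * D l j) ⟩
    ∑[ h < n ] ∑[ l < p ] (A i h * B h l * D l j)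
      ≈⟨ sum-cong-≋ (λ h → sum-cong-≋ (λ l → *-assoc (A i h) (B h l) (D l j))) ⟩
    ∑[ h < n ] ∑[ l < p ] (A i h * (B h l * D l j))
      ≈⟨ sum-cong-≋ (λ h → *-distribˡ-sum (A i h) (λ l → B h l * D l j)) ⟨
    ∑[ h < n ] (A i h * (∑[ l < p ] (B h l * D l j))) ∎

  I-suc : ∀ {n} (i j : Fin n) → I (suc n) (suc i) (suc j) ≈ I n i j
  I-suc i j with i Fin.≟ j
  ... | yes _ = refl
  ... | no  _ = refl

  I-sym : ∀ {n} (i j : Fin n) → I n i j ≈ I n j i
  I-sym i j with i Fin.≟ j | j Fin.≟ i
  ... | yes _   | yes _   = refl
  ... | no  _   | no  _   = refl
  ... | yes i≡j | no  j≢i = ⊥-elim (j≢i (≡.sym i≡j))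
  ... | no  i≢j | yes j≡i = ⊥-elim (i≢j (≡.sym j≡i))

  sum-I : ∀ {n} (f : Vector Carrier n) j → ∑[ l < n ] (f l * I n l j) ≈ f j
  sum-I f zero = begin
    f zero * 1# + ∑[ l < _ ] (f (suc l) * 0#)
      ≈⟨ +-cong (*-identityʳ _) (sum-zero (λ l → zeroʳ (f (suc l)))) ⟩
    f zero + 0# ≈⟨ +-identityʳ _ ⟩
    f zero      ∎
  sum-I f (suc j) = begin
    f zero * 0# + ∑[ l < _ ] (f (suc l) * I _ (suc l) (suc j))
      ≈⟨ +-cong (zeroʳ _) (sum-cong-≋ (λ l → *-congˡ (I-suc l j))) ⟩
    0# + ∑[ l < _ ] (f (suc l) * I _ l j)
      ≈⟨ +-identityˡ _ ⟩
    ∑[ l < _ ] (f (suc l) * I _ l j)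
      ≈⟨ sum-I (λ l → f (suc l)) j ⟩
    f (suc j) ∎

  *ᴹ-identityʳ : ∀ {m n} (A : Matrix m n) → A *ᴹ I n ≈ᴹ A
  *ᴹ-identityʳ A i j = sum-I (A i) j

  *ᴹ-identityˡ : ∀ {m n} (A : Matrix m n) → I m *ᴹ A ≈ᴹ A
  *ᴹ-identityˡ A i j =
    trans (sum-cong-≋ (λ l → trans (*-comm _ _) (*-congˡ (I-sym i l)))) (sum-I (λ l → A l j) i)

  -- One step of symmetric Gaussian elimination with pivot W₀₀.
  module Elimination {k} (W : Matrix (suc k) (suc k)) (pd : IsPositiveDefinite W) where
    open IsPositiveDefinite pd

    a : Carrier
    a = W zero zero

    a>0 : 0# < a
    a>0 = <-Order.<-respʳ-≈ form (positive e₀ (zero , 1#0))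
      where
      e₀ : Vector Carrier (suc k)
      e₀ = 1# ∷ Vector.replicate k 0#

      row : ∀ i → (W *ᵛ e₀) i ≈ W i zero
      row i = trans (+-cong (*-identityʳ _) (sum-zero (λ j → zeroʳ (W i (suc j))))) (+-identityʳ _)

      form : e₀ ∙ (W *ᵛ e₀) ≈ a
      form = trans
        (+-cong (trans (*-identityˡ _) (row zero)) (sum-zero (λ i → zeroˡ ((W *ᵛ e₀) (suc i)))))
        (+-identityʳ a)

    private
      inv : AlgDefs.Invertible _≈_ 1# _*_ (a - 0#)
      inv = #⇒invertible (#-sym (<⇒# a>0))

    a⁻¹ : Carrier
    a⁻¹ = proj₁ inv

    a*a⁻¹≈1 : a * a⁻¹ ≈ 1#
    a*a⁻¹≈1 = trans (*-congʳ (sym (x-0≈x a))) (proj₂ (proj₂ inv))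

    S : Matrix k k
    S i j = W (suc i) (suc j) - W (suc i) zero * (a⁻¹ * W zero (suc j))

    β : Vector Carrier k → Carrier
    β y = ∑[ j < k ] (W zero (suc j) * y j)

    lift : Carrier → Vector Carrier k → Vector Carrier (suc k)
    lift v y = (a⁻¹ * (v - β y)) ∷ y

    lift-zero : ∀ v y → (W *ᵛ lift v y) zero ≈ v
    lift-zero v y = begin
      a * (a⁻¹ * (v - β y)) + β y ≈⟨ +-congʳ (*-assoc a a⁻¹ _) ⟨
      a * a⁻¹ * (v - β y) + β y   ≈⟨ +-congʳ (*-congʳ a*a⁻¹≈1) ⟩
      1# * (v - β y) + β y        ≈⟨ +-congʳ (*-identityˡ _) ⟩
      (v - β y) + β y             ≈⟨ x-y+y≈x v (β y) ⟩
      v                           ∎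

    S-row : ∀ y i → (S *ᵛ y) i ≈
            ∑[ j < k ] (W (suc i) (suc j) * y j) - W (suc i) zero * (a⁻¹ * β y)
    S-row y i = begin
      ∑[ j < k ] (S i j * y j)
        ≈⟨ sum-cong-≋ (λ j → trans (distribʳ (y j) _ _)
             (+-congˡ (trans (sym (-‿distribˡ-* _ (y j)))
               (-‿cong (trans (*-assoc _ _ _) (*-congˡ (*-assoc _ _ _))))))) ⟩
      ∑[ j < k ] (W (suc i) (suc j) * y j - b * (a⁻¹ * t j))
        ≈⟨ ∑-distrib-+ (λ j → W (suc i) (suc j) * y j)
                       (λ j → - (b * (a⁻¹ * t j))) ⟩
      D + ∑[ j < k ] (- (b * (a⁻¹ * t j)))
        ≈⟨ +-congˡ (sum-neg (λ j → b * (a⁻¹ * t j))) ⟩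
      D - ∑[ j < k ] (b * (a⁻¹ * t j))
        ≈⟨ +-congˡ (-‿cong (trans (*-congˡ (*-distribˡ-sum a⁻¹ t)) (*-distribˡ-sum b (λ j → a⁻¹ * t j)))) ⟨
      D - b * (a⁻¹ * β y) ∎
      where
      b = W (suc i) zero
      t : Vector Carrier k
      t j = W zero (suc j) * y j
      D = ∑[ j < k ] (W (suc i) (suc j) * y j)

    lift-suc : ∀ v y i → (W *ᵛ lift v y) (suc i) ≈ (S *ᵛ y) i + W (suc i) zero * (a⁻¹ * v)
    lift-suc v y i = begin
      b * (a⁻¹ * (v - β y)) + D
        ≈⟨ +-congʳ (trans (*-congˡ (*-distribˡ-- a⁻¹ v (β y))) (*-distribˡ-- b _ _)) ⟩
      (b * (a⁻¹ * v) - b * (a⁻¹ * β y)) + D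
        ≈⟨ +-comm _ D ⟩
      D + (b * (a⁻¹ * v) - b * (a⁻¹ * β y))
        ≈⟨ +-congˡ (+-comm _ _) ⟩
      D + (- (b * (a⁻¹ * β y)) + b * (a⁻¹ * v))
        ≈⟨ +-assoc _ _ _ ⟨
      (D - b * (a⁻¹ * β y)) + b * (a⁻¹ * v)
        ≈⟨ +-congʳ (S-row y i) ⟨
      (S *ᵛ y) i + b * (a⁻¹ * v) ∎
      where
      b = W (suc i) zero
      D = ∑[ j < k ] (W (suc i) (suc j) * y j)

    S-pd : IsPositiveDefinite S
    S-pd = record { symmetric = S-sym ; positive = S-pos }
      where
      S-sym : S ᵀ ≈ᴹ S
      S-sym i j = +-cong (symmetric (suc i) (suc j)) (-‿cong (begin
        W (suc j) zero * (a⁻¹ * W zero (suc i)) ≈⟨ *-cong (symmetric zero (suc j)) (*-congˡ (symmetric (suc i) zero)) ⟩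
        W zero (suc j) * (a⁻¹ * W (suc i) zero) ≈⟨ *-assoc _ _ _ ⟨
        W zero (suc j) * a⁻¹ * W (suc i) zero   ≈⟨ *-comm _ _ ⟩
        W (suc i) zero * (W zero (suc j) * a⁻¹) ≈⟨ *-congˡ (*-comm _ _) ⟩
        W (suc i) zero * (a⁻¹ * W zero (suc j)) ∎))

      S-pos : ∀ y → (∃[ i ] y i # 0#) → 0# < y ∙ (S *ᵛ y)
      S-pos y (i , yᵢ#0) = <-Order.<-respʳ-≈ form (positive x (suc i , yᵢ#0))
        where
        x = lift 0# y

        row : ∀ j → (W *ᵛ x) (suc j) ≈ (S *ᵛ y) j
        row j = trans (lift-suc 0# y j)
          (trans (+-congˡ (trans (*-congˡ (zeroʳ a⁻¹)) (zeroʳ _))) (+-identityʳ _))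

        form : x ∙ (W *ᵛ x) ≈ y ∙ (S *ᵛ y)
        form = trans
          (+-cong (trans (*-congˡ (lift-zero 0# y)) (zeroʳ _)) (sum-cong-≋ (λ j → *-congˡ (row j))))
          (+-identityˡ _)

  solve : ∀ {k} (W : Matrix k k) → IsPositiveDefinite W → ∀ v → ∃[ x ] W *ᵛ x ≈ᵛ v
  solve {zero}  W pd v = v , λ ()
  solve {suc k} W pd v = lift (v zero) y , λ where
      zero    → lift-zero (v zero) y
      (suc i) → trans (lift-suc (v zero) y i)
                      (trans (+-congʳ (Sy≈ i)) (x-y+y≈x (v (suc i)) _))
    where
    open Elimination W pd
    sol = solve S S-pd (λ i → v (suc i) - W (suc i) zero * (a⁻¹ * v zero))
    y   = proj₁ sol
    Sy≈ = proj₂ sol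

  -- Inverses of positive definite matrices are obtained from a proof that they exist;
  -- nothing depends on the construction, as inverses are unique.
  positiveDefinite⇒invertible : ∀ {k} {W : Matrix k k} → IsPositiveDefinite W → Invertibleᴹ W
  positiveDefinite⇒invertible {k} {W} pd = V , VW≈I , WV≈I
    where
    open IsPositiveDefinite pd

    V : Matrix k k
    V i j = proj₁ (solve W pd (λ l → I k l j)) i

    WV≈I : W *ᴹ V ≈ᴹ I k
    WV≈I i j = proj₂ (solve W pd (λ l → I k l j)) i

    VᵀW≈I : V ᵀ *ᴹ W ≈ᴹ I k
    VᵀW≈I i j = begin
      ∑[ l < k ] (V l i * W l j) ≈⟨ sum-cong-≋ (λ l → trans (*-comm _ _) (*-congʳ (symmetric j l))) ⟩
      (W *ᴹ V) j i               ≈⟨ WV≈I j i ⟩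
      I k j i                    ≈⟨ I-sym j i ⟩
      I k i j                    ∎

    Vᵀ≈V : V ᵀ ≈ᴹ V
    Vᵀ≈V i j = begin
      (V ᵀ) i j             ≈⟨ *ᴹ-identityʳ (V ᵀ) i j ⟨
      (V ᵀ *ᴹ I k) i j      ≈⟨ sum-cong-≋ (λ l → *-congˡ (WV≈I l j)) ⟨
      (V ᵀ *ᴹ (W *ᴹ V)) i j ≈⟨ *ᴹ-assoc (V ᵀ) W V i j ⟨
      (V ᵀ *ᴹ W *ᴹ V) i j   ≈⟨ sum-cong-≋ (λ l → *-congʳ (VᵀW≈I i l)) ⟩
      (I k *ᴹ V) i j        ≈⟨ *ᴹ-identityˡ V i j ⟩
      V i j                 ∎

    VW≈I : V *ᴹ W ≈ᴹ I k
    VW≈I i j = trans (sum-cong-≋ (λ l → *-congʳ (sym (Vᵀ≈V i l)))) (VᵀW≈I i j)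

  inverse : ∀ {k} {W : Matrix k k} → IsPositiveDefinite W → Matrix k k
  inverse pd = proj₁ (positiveDefinite⇒invertible pd)

  record MatrixWeightedGraph (n k : ℕ) : Set (lsuc 0ℓ ⊔ c ⊔ ℓ₁ ⊔ ℓ₂) where
    field
      graph     : Graph n
      connected : IsConnected graph

    open Graph graph public

    field
      weight    : ∀ {i j} → i ~ j → Matrix k k
      -- As e and e′ are arbitrary, this also makes the weight of an edge
      -- independent of the proof of adjacency.
      weightSym : ∀ {i j} (e : i ~ j) (e′ : j ~ i) → weight e ≈ᴹ weight e′
      weightPD  : ∀ {i j} (e : i ~ j) → IsPositiveDefinite (weight e)

  module _ {n k : ℕ} (G : MatrixWeightedGraph n k) where
    open MatrixWeightedGraph G

    inverseWeight : Fin n → Fin n → Matrix k k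
    inverseWeight i j with i ~? j
    ... | yes e = inverse (weightPD e)
    ... | no  _ = 0ᴹ

    -- The diagonal sum runs over the neighbours of i only, as inverseWeight i l is 0
    -- for all other l (including l = i, by irreflexivity).
    laplacianBlock : Fin n → Fin n → Matrix k k
    laplacianBlock i j with i Fin.≟ j
    ... | yes _ = ∑ᴹ (λ l → inverseWeight i l)
    ... | no  _ = -ᴹ inverseWeight i j

    laplacian : Matrix (n ℕ.* k) (n ℕ.* k)
    laplacian = fromBlocks laplacianBlock

    -- C stands for the chosen (1)-inverse of the Laplacian.
    module _ (C : Matrix (n ℕ.* k) (n ℕ.* k)) where

      resistance : Matrix (n ℕ.* k) (n ℕ.* k)
      resistance = fromBlocks {n} {n} λ i j →
        block C i i +ᴹ block C j j -ᴹ block C i j -ᴹ block C j i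

      τᵢ : Fin n → Matrix k k
      τᵢ i = 2# *ₗ I k +ᴹ ∑ᴹ (λ (j : Fin n) → block laplacian i j *ᴹ block resistance i j)

      τ : Matrix (n ℕ.* k) k
      τ = blockColumn τᵢ

-- Let C be a (1)-inverse of L and P = L C.  Since L C L = L, every row of P - I lies in
-- the left kernel of L, which, as the weights are positive definite and G is connected,
-- consists of the vectors with all blocks equal; so the blocks of P - I do not depend on
-- the block column.  The block rows of L sum to zero, hence so do those of P, and the
-- block trace satisfies ∑ᵢ (I - Pᵢᵢ) = I.  On the other hand the terms Cᵢᵢ and Cⱼⱼ of Rᵢⱼ
-- contribute nothing to ∑ᵢⱼ Lᵢⱼ Rᵢⱼ, and as Lᵢⱼ = Lⱼᵢ the other two contribute -∑ᵢ Pᵢᵢ each.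

module Submission where

open import Defs
open import Data.Nat.Base using (ℕ; _*_)
open import Data.Nat.Properties using (*-identityˡ)
import Data.Nat.Base as ℕ
open import Algebra.Bundles using (CommutativeRing)
import Algebra.Properties.AbelianGroup as AbelianGroupProperties
import Algebra.Properties.CommutativeSemigroup as CommutativeSemigroupProperties
import Algebra.Properties.Ring as RingProperties
import Algebra.Properties.Semiring.Sum as SemiringSum
open import Data.Fin.Base using (Fin; zero; suc; cast; combine; quotient; remainder; _↑ˡ_; _↑ʳ_)
import Data.Fin.Properties as Fin
open import Data.Product using (_,_; proj₁; proj₂)
open import Data.Sum using (_⊎_; inj₁; inj₂)
open import Data.Vec.Functional using (Vector)
open import Relation.Binary.Construct.Closure.ReflexiveTransitive using (Star; ε; _◅_)
open import Relation.Binary.PropositionalEquality as ≡ using (_≡_)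
import Relation.Binary.Reasoning.Setoid as SetoidReasoning
open import Relation.Binary.Structures using (IsStrictPartialOrder)
open import Relation.Nullary using (¬_; yes; no; contradiction)

-- Indices of block matrices

quotient-combine : ∀ {n k} (i : Fin n) (a : Fin k) → quotient k (combine i a) ≡ i
quotient-combine i a = ≡.cong proj₁ (Fin.remQuot-combine i a)

remainder-combine : ∀ {n k} (i : Fin n) (a : Fin k) → remainder {n} k (combine i a) ≡ a
remainder-combine i a = ≡.cong proj₂ (Fin.remQuot-combine i a)

-- Both `cast eq a` and `combine {1} zero a` have the same value as `a`. This identifies the row
-- index produced by `castRows` in the theorem as row `a` of a single block row.
remainder-cast : ∀ {k} (a : Fin k) .(eq : k ≡ 1 * k) → remainder {1} k (cast eq a) ≡ a
remainder-cast {k} a eq =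
  ≡.trans (≡.cong (remainder {1} k) cast≡combine) (remainder-combine {1} zero a)
  where
  cast≡combine : cast eq a ≡ combine {1} zero a
  cast≡combine = Fin.toℕ-injective (≡.trans (Fin.toℕ-cast eq a) (≡.sym (Fin.toℕ-↑ˡ a (0 * k))))

module _ {c ℓ₁ ℓ₂} (ℝ : RealNumbers c ℓ₁ ℓ₂) where
  open RealMatrices ℝ
  open RealNumbers ℝ hiding (zero) renaming (_*_ to _∗_; *-identityˡ to ∗-identityˡ)
  open SemiringSum semiring
  open RingProperties ring using (-‿distribˡ-*; -0#≈0#)
  open AbelianGroupProperties (CommutativeRing.+-abelianGroup commutativeRing)
    using (⁻¹-anti-homo‿-; x∙y⁻¹≈ε⇒x≈y)
  open CommutativeSemigroupProperties (CommutativeRing.+-commutativeSemigroup commutativeRing)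
    using (interchange)
  open SetoidReasoning setoid
  private module < = IsStrictPartialOrder isStrictPartialOrder

  -- Arithmetic of differences

  x≈y⇒x-y≈0 : ∀ {x y} → x ≈ y → x - y ≈ 0#
  x≈y⇒x-y≈0 {x} {y} x≈y = trans (+-congʳ x≈y) (-‿inverseʳ y)

  *-distribʳ-- : ∀ x y z → (y - z) ∗ x ≈ y ∗ x - z ∗ x
  *-distribʳ-- x y z = trans (distribʳ x y (- z)) (+-congˡ (sym (-‿distribˡ-* z x)))

  -- Finite sums

  ∑-distrib-- : ∀ {n} (f g : Vector Carrier n) →
                ∑[ i < n ] (f i - g i) ≈ ∑[ i < n ] f i - ∑[ i < n ] g i
  ∑-distrib-- f g = trans (∑-distrib-+ f (λ i → - g i)) (+-congˡ (sum-neg g))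

  sum-splitAt : ∀ m n (f : Vector Carrier (m ℕ.+ n)) →
                sum f ≈ ∑[ i < m ] f (i ↑ˡ n) + ∑[ j < n ] f (m ↑ʳ j)
  sum-splitAt ℕ.zero    n f = sym (+-identityˡ _)
  sum-splitAt (ℕ.suc m) n f =
    trans (+-congˡ (sum-splitAt m n (λ i → f (suc i)))) (sym (+-assoc _ _ _))

  -- Induction on the number of blocks: `combine zero a` is a left injection and `combine (suc i) a`
  -- is `k ↑ʳ combine i a`, so `sum-splitAt` splits off the first block.
  sum-combine : ∀ n k (f : Vector Carrier (n * k)) →
                sum f ≈ ∑[ i < n ] ∑[ a < k ] f (combine i a)
  sum-combine ℕ.zero    k f = refl
  sum-combine (ℕ.suc n) k f =
    trans (sum-splitAt k (n * k) f) (+-congˡ (sum-combine n k (λ r → f (k ↑ʳ r))))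

  sum-I-row : ∀ {n} (f : Vector Carrier n) j → ∑[ l < n ] (I n j l ∗ f l) ≈ f j
  sum-I-row f j = *ᴹ-identityˡ (λ l (_ : Fin 1) → f l) j zero

  -- Order

  NonNegative : Carrier → Set ℓ₂
  NonNegative x = ¬ x < 0#

  -- Substitute for trichotomy, as the order is not decidable: the apartness `x # y` is
  -- cotransitive, and each resulting apartness is resolved into a strict inequality.
  <-cotrans : ∀ {x y} → x < y → ∀ z → x < z ⊎ z < y
  <-cotrans x<y z with #-cotrans (<⇒# x<y) z
  ... | inj₁ x#z with #⇒<⊎> x#z
  ...   | inj₁ x<z = inj₁ x<z
  ...   | inj₂ z<x = inj₂ (<.trans z<x x<y)
  <-cotrans x<y z | inj₂ z#y with #⇒<⊎> z#y
  ...   | inj₁ z<y = inj₂ z<y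
  ...   | inj₂ y<z = inj₁ (<.trans x<y y<z)

  nonNegative-resp-≈ : ∀ {x y} → x ≈ y → NonNegative x → NonNegative y
  nonNegative-resp-≈ x≈y x≥0 y<0 = x≥0 (<.<-respˡ-≈ (sym x≈y) y<0)

  ≈0⇒nonNegative : ∀ {x} → x ≈ 0# → NonNegative x
  ≈0⇒nonNegative x≈0 = <.irrefl x≈0

  -- Comparing `y` with `x + y < 0#` leaves either `y < 0#` or `x + y < y`; the latter gives
  -- `x < 0#` after subtracting `y`.
  +-nonNegative : ∀ {x y} → NonNegative x → NonNegative y → NonNegative (x + y)
  +-nonNegative {x} {y} x≥0 y≥0 x+y<0 with <-cotrans x+y<0 y
  ... | inj₂ y<0   = y≥0 y<0
  ... | inj₁ x+y<y = x≥0
    (<.<-respʳ-≈ (-‿inverseʳ y)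
      (<.<-respˡ-≈ (trans (+-assoc x y (- y)) (trans (+-congˡ (-‿inverseʳ y)) (+-identityʳ x)))
        (+-monoˡ-< (- y) x+y<y)))

  -- By tightness it suffices to refute `x # 0#`. The case `x < 0#` is excluded directly, and
  -- `0# < x` would give `y < x + y ≈ 0#`.
  nonNegative-x+y≈0⇒x≈0 : ∀ {x y} → NonNegative x → NonNegative y → x + y ≈ 0# → x ≈ 0#
  nonNegative-x+y≈0⇒x≈0 {x} {y} x≥0 y≥0 x+y≈0 = proj₁ (tight x 0#) x¬#0
    where
    x¬#0 : ¬ x # 0#
    x¬#0 x#0 with #⇒<⊎> x#0
    ... | inj₁ x<0 = x≥0 x<0
    ... | inj₂ 0<x = y≥0
      (<.<-respʳ-≈ x+y≈0 (<.<-respˡ-≈ (+-identityˡ y) (+-monoˡ-< y 0<x)))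

  sum-nonNegative : ∀ {n} {f : Vector Carrier n} → (∀ i → NonNegative (f i)) → NonNegative (sum f)
  sum-nonNegative {ℕ.zero}  f≥0 = ≈0⇒nonNegative refl
  sum-nonNegative {ℕ.suc n} f≥0 = +-nonNegative (f≥0 zero) (sum-nonNegative (λ i → f≥0 (suc i)))

  nonNegative-sum≈0 : ∀ {n} {f : Vector Carrier n} → (∀ i → NonNegative (f i)) →
                      sum f ≈ 0# → ∀ i → f i ≈ 0#
  nonNegative-sum≈0 f≥0 ∑f≈0 zero =
    nonNegative-x+y≈0⇒x≈0 (f≥0 zero) (sum-nonNegative (λ i → f≥0 (suc i))) ∑f≈0
  nonNegative-sum≈0 f≥0 ∑f≈0 (suc i) = nonNegative-sum≈0 (λ j → f≥0 (suc j))
    (nonNegative-x+y≈0⇒x≈0 (sum-nonNegative (λ j → f≥0 (suc j))) (f≥0 zero) (trans (+-comm _ _) ∑f≈0)) i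

  -- Matrices

  I-diagonal : ∀ {n} (i : Fin n) → I n i i ≈ 1#
  I-diagonal i with i Fin.≟ i
  ... | yes _   = refl
  ... | no  i≢i = contradiction ≡.refl i≢i

  *ᵛ-assoc : ∀ {m n p} (A : Matrix m n) (B : Matrix n p) (x : Vector Carrier p) →
             A *ᵛ (B *ᵛ x) ≈ᵛ (A *ᴹ B) *ᵛ x
  *ᵛ-assoc A B x i = sym (*ᴹ-assoc A B (λ l (_ : Fin 1) → x l) i zero)

  *ᵛ-cong : ∀ {m n} {A B : Matrix m n} {x y : Vector Carrier n} →
            A ≈ᴹ B → x ≈ᵛ y → A *ᵛ x ≈ᵛ B *ᵛ y
  *ᵛ-cong A≈B x≈y i = sum-cong-≋ (λ j → *-cong (A≈B i j) (x≈y j))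

  *ᴹ-inverse-unique : ∀ {k} {A B W : Matrix k k} → A *ᴹ W ≈ᴹ I k → W *ᴹ B ≈ᴹ I k → A ≈ᴹ B
  *ᴹ-inverse-unique {k} {A} {B} {W} AW≈I WB≈I i j = begin
    A i j               ≈⟨ *ᴹ-identityʳ A i j ⟨
    (A *ᴹ I k) i j      ≈⟨ sum-cong-≋ (λ l → *-congˡ (WB≈I l j)) ⟨
    (A *ᴹ (W *ᴹ B)) i j ≈⟨ *ᴹ-assoc A W B i j ⟨
    (A *ᴹ W *ᴹ B) i j   ≈⟨ sum-cong-≋ (λ l → *-congʳ (AW≈I i l)) ⟩
    (I k *ᴹ B) i j      ≈⟨ *ᴹ-identityˡ B i j ⟩
    B i j               ∎

  -- `inverse` is built from a proof of positive definiteness, and the two orientations of an edge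
  -- carry different proofs. Uniqueness of inverses removes this dependence.
  inverse-cong : ∀ {k} {W W′ : Matrix k k} (pd : IsPositiveDefinite W) (pd′ : IsPositiveDefinite W′) →
                 W ≈ᴹ W′ → inverse pd ≈ᴹ inverse pd′
  inverse-cong {W′ = W′} pd pd′ W≈W′ =
    *ᴹ-inverse-unique
      (proj₁ (proj₂ (positiveDefinite⇒invertible pd)))
      (λ i j → trans (sum-cong-≋ (λ l → *-congʳ (W≈W′ i l)))
        (proj₂ (proj₂ (positiveDefinite⇒invertible pd′)) i j))

  positiveDefinite⇒definite : ∀ {k} {W : Matrix k k} → IsPositiveDefinite W →
                              ∀ x → x ∙ (W *ᵛ x) ≈ 0# → ∀ i → x i ≈ 0#
  positiveDefinite⇒definite pd x xWx≈0 i = proj₁ (tight (x i) 0#)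
    (λ xᵢ#0 → <.irrefl (sym xWx≈0) (IsPositiveDefinite.positive pd x (i , xᵢ#0)))

  -- It cannot be decided whether `x` is zero. But if the form were negative, no coordinate could be
  -- apart from zero, so `x` would vanish by tightness and the form with it.
  positiveDefinite⇒nonNegative : ∀ {k} {W : Matrix k k} → IsPositiveDefinite W →
                                 ∀ x → NonNegative (x ∙ (W *ᵛ x))
  positiveDefinite⇒nonNegative {W = W} pd x xWx<0 = <.irrefl (sum-zero (λ i → trans (*-congʳ (x≈0 i)) (zeroˡ _))) xWx<0
    where
    x≈0 : ∀ i → x i ≈ 0#
    x≈0 i = proj₁ (tight (x i) 0#) (λ xᵢ#0 →
      <.irrefl refl (<.trans xWx<0 (IsPositiveDefinite.positive pd x (i , xᵢ#0))))

  -- Quadratic forms of inverse matrices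

  module _ {k} {W : Matrix k k} (pd : IsPositiveDefinite W) (x : Vector Carrier k) where
    private
      z : Vector Carrier k
      z = inverse pd *ᵛ x

      Wz≈x : W *ᵛ z ≈ᵛ x
      Wz≈x i = trans (*ᵛ-assoc W (inverse pd) x i)
        (trans (*ᵛ-cong (proj₂ (proj₂ (positiveDefinite⇒invertible pd))) (λ _ → refl) i) (sum-I-row x i))

    -- The substitution `x = W z` carries nonnegativity and definiteness over from `W` to its
    -- inverse.
    inverse-form : z ∙ (W *ᵛ z) ≈ x ∙ (inverse pd *ᵛ x)
    inverse-form = sum-cong-≋ (λ i → trans (*-congˡ (Wz≈x i)) (*-comm (z i) (x i)))

    inverse-nonNegative : NonNegative (x ∙ (inverse pd *ᵛ x))
    inverse-nonNegative = nonNegative-resp-≈ inverse-form (positiveDefinite⇒nonNegative pd z)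

    inverse-definite : x ∙ (inverse pd *ᵛ x) ≈ 0# → ∀ i → x i ≈ 0#
    inverse-definite xVx≈0 i = trans (sym (Wz≈x i)) (sum-zero (λ j → trans (*-congˡ (z≈0 j)) (zeroʳ (W i j))))
      where
      z≈0 : ∀ j → z j ≈ 0#
      z≈0 = positiveDefinite⇒definite pd z (trans inverse-form xVx≈0)

  -- The sign is moved into the left factor of the second term, so that it is the first term with
  -- `u` and `v` exchanged. Summed over ordered pairs of vertices, both terms then have the same
  -- shape.
  difference-form : ∀ {k} (M : Matrix k k) (u v : Vector Carrier k) →
    let d = λ a → u a - v a in
    d ∙ (M *ᵛ d) ≈ d ∙ (M *ᵛ u) + (λ a → v a - u a) ∙ (M *ᵛ v)
  difference-form M u v = trans (sum-cong-≋ term)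
    (∑-distrib-+ (λ a → (u a - v a) ∗ (M *ᵛ u) a) (λ a → (v a - u a) ∗ (M *ᵛ v) a))
    where
    row : ∀ a → (M *ᵛ (λ b → u b - v b)) a ≈ (M *ᵛ u) a - (M *ᵛ v) a
    row a = trans (sum-cong-≋ (λ b → *-distribˡ-- (M a b) (u b) (v b)))
      (∑-distrib-- (λ b → M a b ∗ u b) (λ b → M a b ∗ v b))

    term : ∀ a → (u a - v a) ∗ (M *ᵛ (λ b → u b - v b)) a ≈
                 (u a - v a) ∗ (M *ᵛ u) a + (v a - u a) ∗ (M *ᵛ v) a
    term a = trans (*-congˡ (row a)) (trans (*-distribˡ-- _ _ _) (+-congˡ
      (trans (-‿distribˡ-* _ _) (*-congʳ (⁻¹-anti-homo‿- (u a) (v a))))))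

  -- Blocks and block products

  block-fromBlocks : ∀ {m n p q} (B : Fin m → Fin n → Matrix p q) i j → block (fromBlocks B) i j ≈ᴹ B i j
  block-fromBlocks {m} {n} {p} {q} B i j a b
    rewrite quotient-combine i a | quotient-combine j b
          | remainder-combine i a | remainder-combine j b = refl

  block-*ᴹ : ∀ {m n p q r s} (A : Matrix (m * q) (n * r)) (B : Matrix (n * r) (p * s)) i j →
             block {m} {p} (A *ᴹ B) i j ≈ᴹ ∑ᴹ (λ (l : Fin n) → block A i l *ᴹ block B l j)
  block-*ᴹ {n = n} {r = r} A B i j a b = sum-combine n r _

  -- Inverse weights and the Laplacian

  module _ {n k : ℕ} (G : MatrixWeightedGraph n k) where
    open MatrixWeightedGraph G

    private
      V : Fin n → Fin n → Matrix k k
      V = inverseWeight G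
      ℓ : Fin n → Fin n → Matrix k k
      ℓ = laplacianBlock G

    inverseWeight-sym : ∀ i j → V i j ≈ᴹ V j i
    inverseWeight-sym i j a b with i ~? j | j ~? i
    ... | yes e   | yes e′  = inverse-cong (weightPD e) (weightPD e′) (weightSym e e′) a b
    ... | no  _   | no  _   = refl
    ... | yes i~j | no  j≁i = contradiction (~-sym i~j) j≁i
    ... | no  i≁j | yes j~i = contradiction (~-sym j~i) i≁j

    inverseWeight-nonNegative : ∀ i j x → NonNegative (x ∙ (V i j *ᵛ x))
    inverseWeight-nonNegative i j x with i ~? j
    ... | yes e = inverse-nonNegative (weightPD e) x
    ... | no  _ = ≈0⇒nonNegative (sum-zero (λ a → trans (*-congˡ (sum-zero (λ b → zeroˡ (x b)))) (zeroʳ (x a))))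

    inverseWeight-definite : ∀ {i j} → i ~ j → ∀ x → x ∙ (V i j *ᵛ x) ≈ 0# → ∀ a → x a ≈ 0#
    inverseWeight-definite {i} {j} i~j x with i ~? j
    ... | yes e   = inverse-definite (weightPD e) x
    ... | no  i≁j = contradiction i~j i≁j

    laplacianBlock-sym : ∀ i j → ℓ i j ≈ᴹ ℓ j i
    laplacianBlock-sym i j a b with i Fin.≟ j | j Fin.≟ i
    ... | yes ≡.refl | yes _   = refl
    ... | no  _      | no  _   = -‿cong (inverseWeight-sym i j a b)
    ... | yes i≡j    | no  j≢i = contradiction (≡.sym i≡j) j≢i
    ... | no  i≢j    | yes j≡i = contradiction (≡.sym j≡i) i≢j

    -- Degree part minus adjacency part; on the diagonal the subtracted `V i i` is zero by
    -- irreflexivity. The degree is taken at `j` rather than `i`, so that it is a constant factor in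
    -- sums over `i`.
    laplacianBlock-decomposition : ∀ i j a b → ℓ i j a b ≈ I n i j ∗ ∑ᴹ (V j) a b - V i j a b
    laplacianBlock-decomposition i j a b with i Fin.≟ j
    ... | no  _      = sym (trans (+-congʳ (zeroˡ _)) (+-identityˡ _))
    ... | yes ≡.refl = sym (begin
      1# ∗ ∑ᴹ (V i) a b - V i i a b ≈⟨ +-cong (∗-identityˡ _) (-‿cong Vᵢᵢ≈0) ⟩
      ∑ᴹ (V i) a b - 0#             ≈⟨ +-congˡ -0#≈0# ⟩
      ∑ᴹ (V i) a b + 0#             ≈⟨ +-identityʳ _ ⟩
      ∑ᴹ (V i) a b                  ∎)
      where
      Vᵢᵢ≈0 : V i i a b ≈ 0#
      Vᵢᵢ≈0 with i ~? i
      ... | yes i~i = contradiction i~i (~-irrefl ≡.refl)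
      ... | no  _   = refl

    -- The Laplacian as a difference operator: symmetry of `V` turns the degree term into a sum over
    -- the same entries as the adjacency term. Constant `f` gives the column sums, and coordinates
    -- of a kernel vector give `dV≈0`.
    laplacianBlock-action : ∀ (f : Vector Carrier n) j a b →
      ∑[ i < n ] (f i ∗ ℓ i j a b) ≈ ∑[ i < n ] ((f j - f i) ∗ V i j a b)
    laplacianBlock-action f j a b = begin
      ∑[ i < n ] (f i ∗ ℓ i j a b)
        ≈⟨ sum-cong-≋ (λ i → trans (*-congˡ (laplacianBlock-decomposition i j a b)) (*-distribˡ-- _ _ _)) ⟩
      ∑[ i < n ] (f i ∗ (I n i j ∗ D) - f i ∗ V i j a b)
        ≈⟨ ∑-distrib-- (λ i → f i ∗ (I n i j ∗ D)) (λ i → f i ∗ V i j a b) ⟩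
      ∑[ i < n ] (f i ∗ (I n i j ∗ D)) - ∑[ i < n ] (f i ∗ V i j a b)
        ≈⟨ +-congʳ diagonal ⟩
      ∑[ i < n ] (f j ∗ V i j a b) - ∑[ i < n ] (f i ∗ V i j a b)
        ≈⟨ ∑-distrib-- (λ i → f j ∗ V i j a b) (λ i → f i ∗ V i j a b) ⟨
      ∑[ i < n ] (f j ∗ V i j a b - f i ∗ V i j a b)
        ≈⟨ sum-cong-≋ (λ i → *-distribʳ-- (V i j a b) (f j) (f i)) ⟨
      ∑[ i < n ] ((f j - f i) ∗ V i j a b) ∎
      where
      D = ∑ᴹ (V j) a b

      diagonal : ∑[ i < n ] (f i ∗ (I n i j ∗ D)) ≈ ∑[ i < n ] (f j ∗ V i j a b)
      diagonal = begin
        ∑[ i < n ] (f i ∗ (I n i j ∗ D)) ≈⟨ sum-cong-≋ (λ i → *-assoc (f i) (I n i j) D) ⟨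
        ∑[ i < n ] (f i ∗ I n i j ∗ D)   ≈⟨ *-distribʳ-sum D (λ i → f i ∗ I n i j) ⟨
        (∑[ i < n ] (f i ∗ I n i j)) ∗ D ≈⟨ *-congʳ (sum-I f j) ⟩
        f j ∗ D                          ≈⟨ *-distribˡ-sum (f j) (λ l → V j l a b) ⟩
        ∑[ i < n ] (f j ∗ V j i a b)     ≈⟨ sum-cong-≋ (λ i → *-congˡ (inverseWeight-sym j i a b)) ⟩
        ∑[ i < n ] (f j ∗ V i j a b)     ∎

    laplacianBlock-columnSum : ∀ j a b → ∑[ i < n ] ℓ i j a b ≈ 0#
    laplacianBlock-columnSum j a b = begin
      ∑[ i < n ] ℓ i j a b                ≈⟨ sum-cong-≋ (λ i → ∗-identityˡ (ℓ i j a b)) ⟨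
      ∑[ i < n ] (1# ∗ ℓ i j a b)         ≈⟨ laplacianBlock-action (λ _ → 1#) j a b ⟩
      ∑[ i < n ] ((1# - 1#) ∗ V i j a b)  ≈⟨ sum-zero (λ i → trans (*-congʳ (-‿inverseʳ 1#)) (zeroˡ (V i j a b))) ⟩
      0#                                  ∎

    laplacianBlock-rowSum : ∀ i a b → ∑[ j < n ] ℓ i j a b ≈ 0#
    laplacianBlock-rowSum i a b =
      trans (sum-cong-≋ (λ j → laplacianBlock-sym i j a b)) (laplacianBlock-columnSum i a b)

    -- If y L = 0, then ∑ᵢⱼ (yⱼ - yᵢ) Wᵢⱼ⁻¹ (yⱼ - yᵢ)ᵀ = 0 and each summand is nonnegative.
    module LeftKernel (y : Fin n → Vector Carrier k)
                      (yL≈0 : ∀ j b → ∑[ i < n ] ∑[ a < k ] (y i a ∗ ℓ i j a b) ≈ 0#) where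
      private
        d : Fin n → Fin n → Vector Carrier k
        d i j a = y j a - y i a

        dV≈0 : ∀ j b → ∑[ i < n ] ∑[ a < k ] (d i j a ∗ V i j a b) ≈ 0#
        dV≈0 j b = begin
          ∑[ i < n ] ∑[ a < k ] (d i j a ∗ V i j a b)
            ≈⟨ ∑-comm (λ i a → d i j a ∗ V i j a b) ⟩
          ∑[ a < k ] ∑[ i < n ] (d i j a ∗ V i j a b)
            ≈⟨ sum-cong-≋ (λ a → laplacianBlock-action (λ i → y i a) j a b) ⟨
          ∑[ a < k ] ∑[ i < n ] (y i a ∗ ℓ i j a b)
            ≈⟨ ∑-comm (λ i a → y i a ∗ ℓ i j a b) ⟨
          ∑[ i < n ] ∑[ a < k ] (y i a ∗ ℓ i j a b)
            ≈⟨ yL≈0 j b ⟩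
          0# ∎

        -- The vector equation `dV≈0` at `j`, paired with `y j`.
        dVy≈0 : ∀ j → ∑[ i < n ] (d i j ∙ (V i j *ᵛ y j)) ≈ 0#
        dVy≈0 j = begin
          ∑[ i < n ] (d i j ∙ (V i j *ᵛ y j))
            ≈⟨ sum-cong-≋ (λ i → sym (*ᴹ-assoc {1} {p = k} {1} (λ _ → d i j) (V i j) (λ b _ → y j b) zero zero)) ⟩
          ∑[ i < n ] ∑[ b < k ] ((∑[ a < k ] (d i j a ∗ V i j a b)) ∗ y j b)
            ≈⟨ ∑-comm (λ i b → (∑[ a < k ] (d i j a ∗ V i j a b)) ∗ y j b) ⟩
          ∑[ b < k ] ∑[ i < n ] ((∑[ a < k ] (d i j a ∗ V i j a b)) ∗ y j b)
            ≈⟨ sum-zero (λ b → trans (sym (*-distribʳ-sum (y j b) (λ i → ∑[ a < k ] (d i j a ∗ V i j a b))))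
                 (trans (*-congʳ (dV≈0 j b)) (zeroˡ (y j b)))) ⟩
          0# ∎

        q : Fin n → Fin n → Carrier
        q i j = d i j ∙ (V i j *ᵛ d i j)

        -- By symmetry of `V`, the part of the form containing `y i` is the part containing `y j`
        -- with the indices exchanged, so `dVy≈0` disposes of both.
        q≈ : ∀ i j → q i j ≈ d i j ∙ (V i j *ᵛ y j) + d j i ∙ (V j i *ᵛ y i)
        q≈ i j = trans (difference-form (V i j) (y j) (y i))
          (+-congˡ (sum-cong-≋ (λ a → *-congˡ (*ᵛ-cong (inverseWeight-sym i j) (λ _ → refl) a))))

        ∑q≈0 : ∑[ i < n ] ∑[ j < n ] q i j ≈ 0#
        ∑q≈0 = begin
          ∑[ i < n ] ∑[ j < n ] q i j
            ≈⟨ sum-cong-≋ (λ i → trans (sum-cong-≋ (q≈ i))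
                 (∑-distrib-+ (λ j → d i j ∙ (V i j *ᵛ y j)) (λ j → d j i ∙ (V j i *ᵛ y i)))) ⟩
          ∑[ i < n ] (∑[ j < n ] (d i j ∙ (V i j *ᵛ y j)) + ∑[ j < n ] (d j i ∙ (V j i *ᵛ y i)))
            ≈⟨ ∑-distrib-+ (λ i → ∑[ j < n ] (d i j ∙ (V i j *ᵛ y j))) (λ i → ∑[ j < n ] (d j i ∙ (V j i *ᵛ y i))) ⟩
          ∑[ i < n ] ∑[ j < n ] (d i j ∙ (V i j *ᵛ y j)) + ∑[ i < n ] ∑[ j < n ] (d j i ∙ (V j i *ᵛ y i))
            -- `dVy≈0` fixes the vertex whose `y` occurs. In the first sum this is the inner index,
            -- hence the exchange.
            ≈⟨ +-cong (trans (∑-comm (λ i j → d i j ∙ (V i j *ᵛ y j))) (sum-zero dVy≈0)) (sum-zero dVy≈0) ⟩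
          0# + 0#
            ≈⟨ +-identityʳ 0# ⟩
          0# ∎

        q≥0 : ∀ i j → NonNegative (q i j)
        q≥0 i j = inverseWeight-nonNegative i j (d i j)

        q≈0 : ∀ i j → q i j ≈ 0#
        q≈0 i = nonNegative-sum≈0 (q≥0 i) (nonNegative-sum≈0 (λ i′ → sum-nonNegative (q≥0 i′)) ∑q≈0 i)

        constant-on-edges : ∀ {i j} → i ~ j → y i ≈ᵛ y j
        constant-on-edges {i} {j} i~j a =
          sym (x∙y⁻¹≈ε⇒x≈y (y j a) (y i a) (inverseWeight-definite i~j (d i j) (q≈0 i j) a))

        constant-on-paths : ∀ {i j} → Star _~_ i j → y i ≈ᵛ y j
        constant-on-paths ε        a = refl
        constant-on-paths (e ◅ es) a = trans (constant-on-edges e a) (constant-on-paths es a)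

      constant : ∀ i j → y i ≈ᵛ y j
      constant i j = constant-on-paths (IsConnected.path connected i j)

    -- The product of the Laplacian with a (1)-inverse

    module OneInverse (C : Matrix (n * k) (n * k)) (LCL≈L : C IsOneInverseOf laplacian G) where
      private
        L : Matrix (n * k) (n * k)
        L = laplacian G

      P : Fin n → Fin n → Matrix k k
      P i j = ∑ᴹ (λ l → ℓ i l *ᴹ block C l j)

      block-L*C : ∀ i j → block (L *ᴹ C) i j ≈ᴹ P i j
      block-L*C i j a b = trans (block-*ᴹ {n = n} L C i j a b)
        (sum-cong-≋ (λ l → sum-cong-≋ (λ e → *-congʳ (block-fromBlocks ℓ i l a e))))

      P-laplacian : ∀ i j → ∑ᴹ (λ l → P i l *ᴹ ℓ l j) ≈ᴹ ℓ i j
      P-laplacian i j a b = begin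
        ∑[ l < n ] ∑[ e < k ] (P i l a e ∗ ℓ l j e b)
          ≈⟨ sum-cong-≋ (λ l → sum-cong-≋ (λ e → *-cong (block-L*C i l a e) (block-fromBlocks ℓ l j e b))) ⟨
        ∑ᴹ (λ (l : Fin n) → block (L *ᴹ C) i l *ᴹ block L l j) a b
          ≈⟨ block-*ᴹ {n = n} (L *ᴹ C) L i j a b ⟨
        block (L *ᴹ C *ᴹ L) i j a b
          ≈⟨ LCL≈L (combine i a) (combine j b) ⟩
        block L i j a b
          ≈⟨ block-fromBlocks ℓ i j a b ⟩
        ℓ i j a b ∎

      -- The block rows of `L` already sum to zero, and right multiplication by `C` preserves this.
      P-columnSum : ∀ j a b → ∑[ i < n ] P i j a b ≈ 0#
      P-columnSum j a b = begin
        ∑[ i < n ] ∑[ l < n ] ∑[ e < k ] (ℓ i l a e ∗ block C l j e b)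
          ≈⟨ ∑-comm (λ i l → ∑[ e < k ] (ℓ i l a e ∗ block C l j e b)) ⟩
        ∑[ l < n ] ∑[ i < n ] ∑[ e < k ] (ℓ i l a e ∗ block C l j e b)
          ≈⟨ sum-zero (λ l → trans (∑-comm (λ i e → ℓ i l a e ∗ block C l j e b)) (sum-zero (λ e →
               trans (sym (*-distribʳ-sum (block C l j e b) (λ i → ℓ i l a e)))
                 (trans (*-congʳ (laplacianBlock-columnSum l a e)) (zeroˡ _))))) ⟩
        0# ∎

      P-I-constant : ∀ i a b j j′ → P i j a b - I n i j ∗ I k a b ≈ P i j′ a b - I n i j′ ∗ I k a b
      P-I-constant i a b j j′ = LeftKernel.constant y yL≈0 j j′ b
        where
        y : Fin n → Vector Carrier k
        -- Row `(i , a)` of `P - I`, the identity of order `n * k` being split into its two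
        -- Kronecker factors. It lies in the left kernel because `P` and the identity have the same
        -- product with `L`.
        y l e = P i l a e - I n i l ∗ I k a e

        identity-part : ∀ j b → ∑[ l < n ] ∑[ e < k ] (I n i l ∗ I k a e ∗ ℓ l j e b) ≈ ℓ i j a b
        identity-part j b = begin
          ∑[ l < n ] ∑[ e < k ] (I n i l ∗ I k a e ∗ ℓ l j e b)
            ≈⟨ sum-cong-≋ (λ l → trans (sum-cong-≋ (λ e → *-assoc (I n i l) (I k a e) (ℓ l j e b)))
                 (sym (*-distribˡ-sum (I n i l) (λ e → I k a e ∗ ℓ l j e b)))) ⟩
          ∑[ l < n ] (I n i l ∗ ∑[ e < k ] (I k a e ∗ ℓ l j e b))
            ≈⟨ sum-I-row (λ l → ∑[ e < k ] (I k a e ∗ ℓ l j e b)) i ⟩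
          ∑[ e < k ] (I k a e ∗ ℓ i j e b)
            ≈⟨ sum-I-row (λ e → ℓ i j e b) a ⟩
          ℓ i j a b ∎

        yL≈0 : ∀ j b → ∑[ l < n ] ∑[ e < k ] (y l e ∗ ℓ l j e b) ≈ 0#
        yL≈0 j b = begin
          ∑[ l < n ] ∑[ e < k ] (y l e ∗ ℓ l j e b)
            ≈⟨ sum-cong-≋ (λ l → trans (sum-cong-≋ (λ e → *-distribʳ-- (ℓ l j e b) (P i l a e) (I n i l ∗ I k a e)))
                 (∑-distrib-- (λ e → P i l a e ∗ ℓ l j e b) (λ e → I n i l ∗ I k a e ∗ ℓ l j e b))) ⟩
          ∑[ l < n ] (∑[ e < k ] (P i l a e ∗ ℓ l j e b) - ∑[ e < k ] (I n i l ∗ I k a e ∗ ℓ l j e b))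
            ≈⟨ ∑-distrib-- (λ l → ∑[ e < k ] (P i l a e ∗ ℓ l j e b)) (λ l → ∑[ e < k ] (I n i l ∗ I k a e ∗ ℓ l j e b)) ⟩
          ∑ᴹ (λ l → P i l *ᴹ ℓ l j) a b - ∑[ l < n ] ∑[ e < k ] (I n i l ∗ I k a e ∗ ℓ l j e b)
            ≈⟨ x≈y⇒x-y≈0 (trans (P-laplacian i j a b) (sym (identity-part j b))) ⟩
          0# ∎

      -- P - I is constant along block rows, so its block trace is the column sum of P - I
      -- in any fixed block column.
      P-trace : Fin n → ∀ a b → ∑[ i < n ] (I k a b - P i i a b) ≈ I k a b
      P-trace j a b = begin
        ∑[ i < n ] (I k a b - P i i a b)
          ≈⟨ sum-cong-≋ term ⟩
        ∑[ i < n ] (I k a b ∗ I n i j - P i j a b)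
          ≈⟨ ∑-distrib-- (λ i → I k a b ∗ I n i j) (λ i → P i j a b) ⟩
        ∑[ i < n ] (I k a b ∗ I n i j) - ∑[ i < n ] P i j a b
          ≈⟨ +-cong (sum-I (λ _ → I k a b) j) (-‿cong (P-columnSum j a b)) ⟩
        I k a b - 0#
          ≈⟨ trans (+-congˡ -0#≈0#) (+-identityʳ _) ⟩
        I k a b ∎
        where
        term : ∀ i → I k a b - P i i a b ≈ I k a b ∗ I n i j - P i j a b
        term i = begin
          I k a b - P i i a b                  ≈⟨ ⁻¹-anti-homo‿- _ _ ⟨
          - (P i i a b - I k a b)              ≈⟨ -‿cong (+-congˡ (-‿cong (trans (*-congʳ (I-diagonal i)) (∗-identityˡ _)))) ⟨
          - (P i i a b - I n i i ∗ I k a b)    ≈⟨ -‿cong (P-I-constant i a b i j) ⟩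
          - (P i j a b - I n i j ∗ I k a b)    ≈⟨ ⁻¹-anti-homo‿- _ _ ⟩
          I n i j ∗ I k a b - P i j a b        ≈⟨ +-congʳ (*-comm _ _) ⟩
          I k a b ∗ I n i j - P i j a b        ∎

      -- Summing products with the Laplacian blocks

      pairing : (Fin n → Fin n → Matrix k k) → Matrix k k
      pairing X = ∑ᴹ (λ i → ∑ᴹ (λ j → ℓ i j *ᴹ X i j))

      pairing-cong : ∀ {X Y} → (∀ i j → X i j ≈ᴹ Y i j) → pairing X ≈ᴹ pairing Y
      pairing-cong X≈Y a b =
        sum-cong-≋ (λ i → sum-cong-≋ (λ j → sum-cong-≋ (λ e → *-congˡ (X≈Y i j e b))))

      pairing-+ : ∀ X Y → pairing (λ i j → X i j +ᴹ Y i j) ≈ᴹ pairing X +ᴹ pairing Y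
      pairing-+ X Y a b = trans
        (sum-cong-≋ (λ i → trans
          (sum-cong-≋ (λ j → trans
            (sum-cong-≋ (λ e → distribˡ (ℓ i j a e) (X i j e b) (Y i j e b)))
            (∑-distrib-+ (λ e → ℓ i j a e ∗ X i j e b) (λ e → ℓ i j a e ∗ Y i j e b))))
          (∑-distrib-+ (λ j → (ℓ i j *ᴹ X i j) a b) (λ j → (ℓ i j *ᴹ Y i j) a b))))
        (∑-distrib-+ (λ i → ∑ᴹ (λ j → ℓ i j *ᴹ X i j) a b) (λ i → ∑ᴹ (λ j → ℓ i j *ᴹ Y i j) a b))

      pairing-- : ∀ X Y → pairing (λ i j → X i j -ᴹ Y i j) ≈ᴹ pairing X -ᴹ pairing Y
      pairing-- X Y a b = trans
        (sum-cong-≋ (λ i → trans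
          (sum-cong-≋ (λ j → trans
            (sum-cong-≋ (λ e → *-distribˡ-- (ℓ i j a e) (X i j e b) (Y i j e b)))
            (∑-distrib-- (λ e → ℓ i j a e ∗ X i j e b) (λ e → ℓ i j a e ∗ Y i j e b))))
          (∑-distrib-- (λ j → (ℓ i j *ᴹ X i j) a b) (λ j → (ℓ i j *ᴹ Y i j) a b))))
        (∑-distrib-- (λ i → ∑ᴹ (λ j → ℓ i j *ᴹ X i j) a b) (λ i → ∑ᴹ (λ j → ℓ i j *ᴹ Y i j) a b))

      -- `X i` factors out of the sum over `j`, leaving a vanishing block row sum of the Laplacian.
      pairing-rowConstant : ∀ (X : Fin n → Matrix k k) → pairing (λ i _ → X i) ≈ᴹ 0ᴹ
      pairing-rowConstant X a b = sum-zero (λ i → trans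
        (∑-comm (λ j e → ℓ i j a e ∗ X i e b))
        (sum-zero (λ e → trans (sym (*-distribʳ-sum (X i e b) (λ j → ℓ i j a e)))
          (trans (*-congʳ (laplacianBlock-rowSum i a e)) (zeroˡ (X i e b))))))

      -- Exchange the summations and use that the blocks at `(i , j)` and `(j , i)` are equal. This
      -- reduces the `Cⱼⱼ` terms to the `Cᵢᵢ` terms and the `Cᵢⱼ` terms to the `Cⱼᵢ` terms.
      pairing-transpose : ∀ X → pairing (λ i j → X j i) ≈ᴹ pairing X
      pairing-transpose X a b = trans
        (∑-comm (λ i j → ∑[ e < k ] (ℓ i j a e ∗ X j i e b)))
        (sum-cong-≋ (λ j → sum-cong-≋ (λ i → sum-cong-≋ (λ e → *-congʳ (laplacianBlock-sym i j a e)))))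

      trP : Matrix k k
      trP = ∑ᴹ (λ i → P i i)

      pairing-resistance : pairing (block (resistance G C)) ≈ᴹ (-ᴹ trP) +ᴹ (-ᴹ trP)
      pairing-resistance a b = begin
        pairing (block (resistance G C)) a b
          ≈⟨ pairing-cong (block-fromBlocks (λ i j → X₁ i j +ᴹ X₂ i j -ᴹ X₃ i j -ᴹ X₄ i j)) a b ⟩
        pairing (λ i j → X₁ i j +ᴹ X₂ i j -ᴹ X₃ i j -ᴹ X₄ i j) a b
          -- `pairing X₄` is `trP` by definition: its inner sum over `j` is the diagonal block
          -- `P i i`.
          ≈⟨ pairing-- (λ i j → X₁ i j +ᴹ X₂ i j -ᴹ X₃ i j) X₄ a b ⟩
        pairing (λ i j → X₁ i j +ᴹ X₂ i j -ᴹ X₃ i j) a b - trP a b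
          ≈⟨ +-congʳ (pairing-- (λ i j → X₁ i j +ᴹ X₂ i j) X₃ a b) ⟩
        pairing (λ i j → X₁ i j +ᴹ X₂ i j) a b - pairing X₃ a b - trP a b
          ≈⟨ +-congʳ (+-cong (pairing-+ X₁ X₂ a b) (-‿cong (pairing-transpose X₄ a b))) ⟩
        pairing X₁ a b + pairing X₂ a b - trP a b - trP a b
          ≈⟨ +-congʳ (+-congʳ (+-cong X₁≈0 (trans (pairing-transpose X₁ a b) X₁≈0))) ⟩
        0# + 0# - trP a b - trP a b
          ≈⟨ +-congʳ (trans (+-congʳ (+-identityˡ 0#)) (+-identityˡ _)) ⟩
        - trP a b - trP a b ∎
        where
        X₁ X₂ X₃ X₄ : Fin n → Fin n → Matrix k k
        X₁ i j = block C i i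
        X₂ i j = block C j j
        X₃ i j = block C i j
        X₄ i j = block C j i
        X₁≈0 : pairing X₁ a b ≈ 0#
        X₁≈0 = pairing-rowConstant (λ i → block C i i) a b

      -- The total is twice the sum of all `I k - P i i`, which `P-trace` evaluates. The vertex
      -- argument supplies the block column that `P-trace` works with.
      ∑τ : Fin n → ∑ᴹ (τᵢ G C) ≈ᴹ 2# *ₗ I k
      ∑τ i₀ a b = begin
        ∑[ i < n ] (2# ∗ I k a b + ∑ᴹ (λ (j : Fin n) → block L i j *ᴹ block (resistance G C) i j) a b)
          ≈⟨ sum-cong-≋ (λ i → +-cong double
               (sum-cong-≋ (λ j → sum-cong-≋ (λ e → *-congʳ (block-fromBlocks ℓ i j a e))))) ⟩
        ∑[ i < n ] ((I k a b + I k a b) + ∑ᴹ (λ j → ℓ i j *ᴹ block (resistance G C) i j) a b)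
          ≈⟨ ∑-distrib-+ (λ _ → I k a b + I k a b) (λ i → ∑ᴹ (λ j → ℓ i j *ᴹ block (resistance G C) i j) a b) ⟩
        ∑[ i < n ] (I k a b + I k a b) + pairing (block (resistance G C)) a b
          ≈⟨ +-cong (∑-distrib-+ {n} (λ _ → I k a b) (λ _ → I k a b)) (pairing-resistance a b) ⟩
        (∑[ i < n ] I k a b + ∑[ i < n ] I k a b) + (- trP a b - trP a b)
          ≈⟨ interchange _ _ _ _ ⟩
        (∑[ i < n ] I k a b - trP a b) + (∑[ i < n ] I k a b - trP a b)
          ≈⟨ +-cong ∑I-trP ∑I-trP ⟩
        I k a b + I k a b
          ≈⟨ double ⟨
        2# ∗ I k a b ∎
        where
        double : ∀ {x} → 2# ∗ x ≈ x + x
        double {x} = trans (distribʳ x 1# 1#) (+-cong (∗-identityˡ x) (∗-identityˡ x))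

        ∑I-trP : ∑[ i < n ] I k a b - trP a b ≈ I k a b
        ∑I-trP = trans (sym (∑-distrib-- (λ _ → I k a b) (λ i → P i i a b))) (P-trace i₀ a b)

  -- From the block column to the sum of its blocks

  blockColumn-sum : ∀ {n k q} (B : Fin n → Matrix k q) →
    castRows (*-identityˡ k) ((𝟏 n ᵀ ⊗ I k) *ᴹ blockColumn B) ≈ᴹ ∑ᴹ B
  blockColumn-sum {n} {k} B a b = begin
    ((𝟏 n ᵀ ⊗ I k) *ᴹ blockColumn B) a′ b
      ≈⟨ sum-combine n k _ ⟩
    ∑[ i < n ] ∑[ e < k ] ((𝟏 n ᵀ ⊗ I k) a′ (combine i e) ∗ blockColumn B (combine i e) b)
      ≈⟨ sum-cong-≋ (λ i → sum-cong-≋ (term i)) ⟩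
    ∑[ i < n ] ∑[ e < k ] (I k a e ∗ B i e b)
      ≈⟨ sum-cong-≋ (λ i → sum-I-row (λ e → B i e b) a) ⟩
    ∑ᴹ B a b ∎
    where
    a′ : Fin (1 * k)
    a′ = cast (≡.sym (*-identityˡ k)) a

    term : ∀ i e → (𝟏 n ᵀ ⊗ I k) a′ (combine i e) ∗ blockColumn B (combine i e) b ≈ I k a e ∗ B i e b
    term i e rewrite remainder-cast a (≡.sym (*-identityˡ k)) | quotient-combine i e | remainder-combine i e =
      *-congʳ (∗-identityˡ _)

  -- Nonemptiness is part of connectedness here; it provides the block column in which `P-trace` is
  -- evaluated.
  vertex : ∀ {n} {G : Graph n} → IsConnected G → Fin n
  vertex {ℕ.suc n} _ = zero
  vertex {ℕ.zero} G-connected =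
    contradiction ≡.refl (ℕ.≢-nonZero⁻¹ 0 {{IsConnected.nonEmpty G-connected}})

theorem3p6 : ∀ {c ℓ₁ ℓ₂} (ℝ : RealNumbers c ℓ₁ ℓ₂) →
    let open RealMatrices ℝ in
    (n k : ℕ) (G : MatrixWeightedGraph n k) →
    (L⁽¹⁾ : Matrix (n * k) (n * k)) → L⁽¹⁾ IsOneInverseOf laplacian G →
    castRows (*-identityˡ k) ((𝟏 n ᵀ ⊗ I k) *ᴹ τ G L⁽¹⁾) ≈ᴹ 2# *ₗ I k
theorem3p6 ℝ n k G L⁽¹⁾ LCL≈L a b = trans
  (blockColumn-sum ℝ (τᵢ G L⁽¹⁾) a b)
  (OneInverse.∑τ ℝ G L⁽¹⁾ LCL≈L (vertex ℝ (MatrixWeightedGraph.connected G)) a b)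
  where
  open RealNumbers ℝ using (trans)
  open RealMatrices ℝ
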